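{- Let $k>1$ and let $\mathcal P$ be any $k$-pattern in $\mathbb R$ under direct similarity. If $n$ is a positive integer and $r$ is the remainder when $n$ is divided by $k-1$, then $S_{\mathcal P}(n)\le (n-r)(n+r-k+1)/(2k-2)$.
   Context: A direct similarity of $\mathbb R$ is a map $x\mapsto ax+b$ with $a>0$, $b\in\mathbb R$. A $k$-pattern in $\mathbb R$ under direct similarity is the set $\mathcal P$ of all images of a fixed $k$-element set $P_0\subseteq\mathbb R$ under direct similarities. For finite $V\subseteq\mathbb R$, $S_{\mathcal P}(V)=|\{P\subseteq V:P\in\mathcal P\}|$ and $S_{\mathcal P}(n)=\max\{S_{\mathcal P}(V):V\subseteq\mathbb R,\ |V|=n\}$. -}

module Defs where

open import Level using (0ℓ)
open import Data.Nat as ℕ using (ℕ; zero; suc; z≤n; s≤s; NonZero; NonTrivial; _⊔_)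
import Data.Nat.Properties as ℕ
open import Data.Integer as ℤ using (+_)
import Data.Integer.Properties as ℤ
open import Data.Rational as ℚ using (ℚ; 0ℚ; 1ℚ; ½; ∣_∣; Positive; NonNegative; positive; nonNegative)
import Data.Rational.Properties as ℚ
open import Data.Rational.Literals using (fromℤ)
open import Data.Rational.Solver using (module +-*-Solver)
open import Data.Bool using (true; false)
open import Data.Fin using (Fin; toℕ)
open import Data.Fin.Properties using (toℕ-injective)
open import Data.Fin.Subset using (Subset; _∈_)
open import Data.Vec using ([]; _∷_)
import Data.Vec.Properties as Vec
import Data.Bool.Properties as Bool
open import Data.List as List using (List; []; _∷_; length; map; _++_; filter)
import Data.List.Properties as List
import Data.List.Membership.Propositional as List
import Data.List.Membership.DecPropositional as DecMembership
open import Data.List.Membership.Propositional.Properties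
  using (∈-map⁺; ∈-map⁻; ∈-++⁺ˡ; ∈-++⁺ʳ; ∈-filter⁺; ∈-filter⁻)
open import Data.List.Membership.Propositional.Properties.WithK using (unique∧set⇒bag)
open import Data.List.Relation.Binary.BagAndSetEquality using (∼bag⇒↭)
open import Data.List.Relation.Binary.Permutation.Propositional.Properties using (↭-length)
open import Data.List.Relation.Unary.Any using (here; there)
open import Data.List.Relation.Unary.AllPairs using ([]; _∷_)
open import Data.List.Relation.Unary.All using ([])
open import Data.List.Relation.Unary.Unique.Propositional using (Unique)
import Data.List.Relation.Unary.Unique.Propositional.Properties as Unique
open import Data.Product using (Σ; ∃; _×_; _,_; proj₁; proj₂)
open import Data.Sum using (inj₁; inj₂)
open import Function using (_∘_; _⇔_; mk⇔; Injective)
open import Relation.Binary.PropositionalEquality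
open import Relation.Nullary
open import Relation.Nullary.Decidable using (¬¬-excluded-middle)
open import Relation.Unary using (Pred; _≐_)

------------------------------------------------------------------------
-- The real numbers, as Cauchy sequences of rationals under the
-- equivalence _≈_ (Agda has no quotient types).

IsCauchy : (ℕ → ℚ) → Set
IsCauchy x = ∀ ε → 0ℚ ℚ.< ε →
  ∃ λ N → ∀ m n → N ℕ.≤ m → N ℕ.≤ n → ∣ x m ℚ.- x n ∣ ℚ.< ε

record ℝ : Set where
  constructor mkℝ
  field
    seq    : ℕ → ℚ
    cauchy : IsCauchy seq

open ℝ public

infix 4 _≈_ _<_

record _≈_ (x y : ℝ) : Set where
  constructor mk≈
  field
    close : ∀ ε → 0ℚ ℚ.< ε →
      ∃ λ N → ∀ n → N ℕ.≤ n → ∣ seq x n ℚ.- seq y n ∣ ℚ.< ε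

-- The gap ε excludes sequences that are eventually ordered but equivalent.
record _<_ (x y : ℝ) : Set where
  constructor mk<
  field
    ε      : ℚ
    0<ε    : 0ℚ ℚ.< ε
    N      : ℕ
    behind : ∀ n → N ℕ.≤ n → seq x n ℚ.+ ε ℚ.< seq y n

fromℚ : ℚ → ℝ
fromℚ q = mkℝ (λ _ → q) λ ε 0<ε →
  0 , λ _ _ _ _ → subst (ℚ._< ε) (sym (cong ∣_∣ (ℚ.+-inverseʳ q))) 0<ε

0ℝ : ℝ
0ℝ = fromℚ 0ℚ

private
  half-pos : ∀ {ε} → 0ℚ ℚ.< ε → 0ℚ ℚ.< ½ ℚ.* ε
  half-pos {ε} 0<ε = ℚ.positive⁻¹ _ {{ℚ.pos*pos⇒pos ½ ε {{positive 0<ε}}}}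

  half+half : ∀ ε → ½ ℚ.* ε ℚ.+ ½ ℚ.* ε ≡ ε
  half+half ε = trans (sym (ℚ.*-distribʳ-+ ε ½ ½)) (ℚ.*-identityˡ ε)

  +-cauchy : ∀ x y → IsCauchy x → IsCauchy y → IsCauchy (λ n → x n ℚ.+ y n)
  +-cauchy x y cx cy ε 0<ε
    with M , hx ← cx _ (half-pos 0<ε) | N , hy ← cy _ (half-pos 0<ε)
    = M ⊔ N , λ m n m≥ n≥ → begin-strict
      ∣ (x m ℚ.+ y m) ℚ.- (x n ℚ.+ y n) ∣
        ≡⟨ cong ∣_∣ (rearrange (x m) (y m) (x n) (y n)) ⟩
      ∣ (x m ℚ.- x n) ℚ.+ (y m ℚ.- y n) ∣
        ≤⟨ ℚ.∣p+q∣≤∣p∣+∣q∣ (x m ℚ.- x n) (y m ℚ.- y n) ⟩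
      ∣ x m ℚ.- x n ∣ ℚ.+ ∣ y m ℚ.- y n ∣
        <⟨ ℚ.+-mono-< (hx m n (ℕ.m⊔n≤o⇒m≤o M N m≥) (ℕ.m⊔n≤o⇒m≤o M N n≥))
                      (hy m n (ℕ.m⊔n≤o⇒n≤o M N m≥) (ℕ.m⊔n≤o⇒n≤o M N n≥)) ⟩
      ½ ℚ.* ε ℚ.+ ½ ℚ.* ε
        ≡⟨ half+half ε ⟩
      ε ∎
    where
    open ℚ.≤-Reasoning
    open +-*-Solver
    rearrange : ∀ a b c d →
      (a ℚ.+ b) ℚ.- (c ℚ.+ d) ≡ (a ℚ.- c) ℚ.+ (b ℚ.- d)
    rearrange = solve 4 (λ a b c d →
      (a :+ b) :- (c :+ d) := (a :- c) :+ (b :- d)) refl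

  cauchy-bounded : ∀ {x} → IsCauchy x →
    ∃ λ B → 0ℚ ℚ.< B × ∃ λ N → ∀ n → N ℕ.≤ n → ∣ x n ∣ ℚ.≤ B
  cauchy-bounded {x} cx with N , h ← cx 1ℚ (ℚ.positive⁻¹ 1ℚ)
    = 1ℚ ℚ.+ ∣ x N ∣
    , ℚ.+-mono-<-≤ (ℚ.positive⁻¹ 1ℚ) (ℚ.0≤∣p∣ (x N))
    , N , λ n n≥ → begin
      ∣ x n ∣                        ≡⟨ cong ∣_∣ (split (x n) (x N)) ⟩
      ∣ (x n ℚ.- x N) ℚ.+ x N ∣      ≤⟨ ℚ.∣p+q∣≤∣p∣+∣q∣ (x n ℚ.- x N) (x N) ⟩
      ∣ x n ℚ.- x N ∣ ℚ.+ ∣ x N ∣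
        ≤⟨ ℚ.+-monoˡ-≤ ∣ x N ∣ (ℚ.<⇒≤ (h n N n≥ ℕ.≤-refl)) ⟩
      1ℚ ℚ.+ ∣ x N ∣ ∎
    where
    open ℚ.≤-Reasoning
    open +-*-Solver
    split : ∀ a b → a ≡ (a ℚ.- b) ℚ.+ b
    split = solve 2 (λ a b → a := (a :- b) :+ b) refl

  shrink : ∀ B ε → 0ℚ ℚ.< B → 0ℚ ℚ.< ε →
    ∃ λ δ → 0ℚ ℚ.< δ × B ℚ.* δ ≡ ε
  shrink B ε 0<B 0<ε = δ , 0<δ , Bδ≡ε
    where
    instance
      B-pos : Positive B
      B-pos = positive 0<B
      B-nonZero : ℚ.NonZero B
      B-nonZero = ℚ.pos⇒nonZero B
    δ = (ℚ.1/ B) ℚ.* ε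
    0<δ : 0ℚ ℚ.< δ
    0<δ = ℚ.positive⁻¹ δ
      {{ℚ.pos*pos⇒pos (ℚ.1/ B) {{ℚ.1/pos⇒pos B}} ε {{positive 0<ε}}}}
    Bδ≡ε : B ℚ.* δ ≡ ε
    Bδ≡ε = trans (sym (ℚ.*-assoc B (ℚ.1/ B) ε))
      (trans (cong (ℚ._* ε) (ℚ.*-inverseʳ B)) (ℚ.*-identityˡ ε))

  ∣*∣-mono : ∀ {B δ} p q → 0ℚ ℚ.< B → ∣ p ∣ ℚ.≤ B → ∣ q ∣ ℚ.< δ →
    ∣ p ℚ.* q ∣ ℚ.< B ℚ.* δ
  ∣*∣-mono {B} {δ} p q 0<B p≤B q<δ = begin-strict
    ∣ p ℚ.* q ∣      ≡⟨ ℚ.∣p*q∣≡∣p∣*∣q∣ p q ⟩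
    ∣ p ∣ ℚ.* ∣ q ∣
      ≤⟨ ℚ.*-monoʳ-≤-nonNeg ∣ q ∣ {{nonNegative (ℚ.0≤∣p∣ q)}} p≤B ⟩
    B ℚ.* ∣ q ∣      <⟨ ℚ.*-monoʳ-<-pos B {{positive 0<B}} q<δ ⟩
    B ℚ.* δ ∎
    where open ℚ.≤-Reasoning

  *-cauchy : ∀ x y → IsCauchy x → IsCauchy y → IsCauchy (λ n → x n ℚ.* y n)
  *-cauchy x y cx cy ε 0<ε
    = let A , 0<A , M₁ , x≤A = cauchy-bounded cx
          B , 0<B , N₁ , y≤B = cauchy-bounded cy
          α , 0<α , Aα = shrink A (½ ℚ.* ε) 0<A (half-pos 0<ε)
          β , 0<β , Bβ = shrink B (½ ℚ.* ε) 0<B (half-pos 0<ε)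
          M₂ , hx = cx β 0<β
          N₂ , hy = cy α 0<α
      in (M₁ ⊔ N₁) ⊔ (M₂ ⊔ N₂) , λ m n m≥ n≥ →
      let m≥₁ = ℕ.m⊔n≤o⇒m≤o (M₁ ⊔ N₁) (M₂ ⊔ N₂) m≥
          m≥₂ = ℕ.m⊔n≤o⇒n≤o (M₁ ⊔ N₁) (M₂ ⊔ N₂) m≥
          n≥₁ = ℕ.m⊔n≤o⇒m≤o (M₁ ⊔ N₁) (M₂ ⊔ N₂) n≥
          n≥₂ = ℕ.m⊔n≤o⇒n≤o (M₁ ⊔ N₁) (M₂ ⊔ N₂) n≥
      in begin-strict
      ∣ x m ℚ.* y m ℚ.- x n ℚ.* y n ∣
        ≡⟨ cong ∣_∣ (rearrange (x m) (y m) (x n) (y n)) ⟩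
      ∣ x m ℚ.* (y m ℚ.- y n) ℚ.+ y n ℚ.* (x m ℚ.- x n) ∣
        ≤⟨ ℚ.∣p+q∣≤∣p∣+∣q∣ (x m ℚ.* (y m ℚ.- y n)) (y n ℚ.* (x m ℚ.- x n)) ⟩
      ∣ x m ℚ.* (y m ℚ.- y n) ∣ ℚ.+ ∣ y n ℚ.* (x m ℚ.- x n) ∣
        <⟨ ℚ.+-mono-<
             (∣*∣-mono (x m) (y m ℚ.- y n) 0<A
               (x≤A m (ℕ.m⊔n≤o⇒m≤o M₁ N₁ m≥₁))
               (hy m n (ℕ.m⊔n≤o⇒n≤o M₂ N₂ m≥₂) (ℕ.m⊔n≤o⇒n≤o M₂ N₂ n≥₂)))
             (∣*∣-mono (y n) (x m ℚ.- x n) 0<B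
               (y≤B n (ℕ.m⊔n≤o⇒n≤o M₁ N₁ n≥₁))
               (hx m n (ℕ.m⊔n≤o⇒m≤o M₂ N₂ m≥₂) (ℕ.m⊔n≤o⇒m≤o M₂ N₂ n≥₂))) ⟩
      A ℚ.* α ℚ.+ B ℚ.* β
        ≡⟨ cong₂ ℚ._+_ Aα Bβ ⟩
      ½ ℚ.* ε ℚ.+ ½ ℚ.* ε
        ≡⟨ half+half ε ⟩
      ε ∎
    where
    open ℚ.≤-Reasoning
    open +-*-Solver
    rearrange : ∀ a b c d →
      a ℚ.* b ℚ.- c ℚ.* d ≡ a ℚ.* (b ℚ.- d) ℚ.+ d ℚ.* (a ℚ.- c)
    rearrange = solve 4 (λ a b c d →
      a :* b :- c :* d := a :* (b :- d) :+ d :* (a :- c)) refl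

infixl 6 _+_
infixl 7 _*_

_+_ : ℝ → ℝ → ℝ
x + y = mkℝ (λ n → seq x n ℚ.+ seq y n)
  (+-cauchy (seq x) (seq y) (cauchy x) (cauchy y))

_*_ : ℝ → ℝ → ℝ
x * y = mkℝ (λ n → seq x n ℚ.* seq y n)
  (*-cauchy (seq x) (seq y) (cauchy x) (cauchy y))

------------------------------------------------------------------------
-- Finite point sets and patterns

record PointSet (n : ℕ) : Set where
  field
    point    : Fin n → ℝ
    distinct : Injective _≡_ _≈_ point

open PointSet public

⟦_⟧ : ∀ {n} → PointSet n → Pred ℝ 0ℓ
⟦ V ⟧ x = ∃ λ i → x ≈ point V i

-- Since the points of V are distinct, I ↦ V ↾ I is a bijection between
-- Subset n and the subsets of ⟦ V ⟧.
_↾_ : ∀ {n} → PointSet n → Subset n → Pred ℝ 0ℓ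
(V ↾ I) x = ∃ λ i → i ∈ I × x ≈ point V i

record DirectSimilarity : Set where
  field
    a b : ℝ
    a>0 : 0ℝ < a

  apply : ℝ → ℝ
  apply x = a * x + b

open DirectSimilarity public using (apply)

image : DirectSimilarity → Pred ℝ 0ℓ → Pred ℝ 0ℓ
image f A y = ∃ λ x → A x × y ≈ apply f x

IsPattern : ℕ → Pred (Pred ℝ 0ℓ) 0ℓ → Set₁
IsPattern k 𝒫 =
  Σ (PointSet k) λ P₀ → 𝒫 ≐ λ P → ∃ λ (f : DirectSimilarity) → P ≐ image f ⟦ P₀ ⟧

------------------------------------------------------------------------
-- The counting functions, as relations. Membership in 𝒫 is not decidable,
-- so neither of them can be given as a computable function to ℕ.

-- S_𝒫(V) = m : the subsets of V that lie in 𝒫 are enumerated without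
-- repetition by a list of length m.
S[_,_]≡_ : ∀ {n} → Pred (Pred ℝ 0ℓ) 0ℓ → PointSet n → ℕ → Set
S[_,_]≡_ {n} 𝒫 V m = Σ (List (Subset n)) λ Is →
  Unique Is × (∀ I → I List.∈ Is ⇔ 𝒫 (V ↾ I)) × length Is ≡ m

-- S_𝒫(n) = m
Smax[_,_]≡_ : Pred (Pred ℝ 0ℓ) 0ℓ → ℕ → ℕ → Set
Smax[ 𝒫 , n ]≡ m =
  (Σ (PointSet n) λ V → S[ 𝒫 , V ]≡ m) ×
  (∀ (V : PointSet n) m′ → S[ 𝒫 , V ]≡ m′ → m′ ℕ.≤ m)

------------------------------------------------------------------------
-- Both values exist up to double negation (classically: exist). As _≤_ on
-- ℕ is stable, a bound N on every m with Smax[ 𝒫 , n ]≡ m therefore bounds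
-- the number of subsets in 𝒫 of every n-point set.

private
  allSubsets : ∀ n → List (Subset n)
  allSubsets zero    = [] ∷ []
  allSubsets (suc n) = map (true ∷_) (allSubsets n) ++ map (false ∷_) (allSubsets n)

  ∈-allSubsets : ∀ {n} (I : Subset n) → I List.∈ allSubsets n
  ∈-allSubsets []          = here refl
  ∈-allSubsets (true ∷ I)  = ∈-++⁺ˡ (∈-map⁺ (true ∷_) (∈-allSubsets I))
  ∈-allSubsets (false ∷ I) = ∈-++⁺ʳ _ (∈-map⁺ (false ∷_) (∈-allSubsets I))

  unique-allSubsets : ∀ n → Unique (allSubsets n)
  unique-allSubsets zero    = [] ∷ []
  unique-allSubsets (suc n) = Unique.++⁺
    (Unique.map⁺ Vec.∷-injectiveʳ (unique-allSubsets n))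
    (Unique.map⁺ Vec.∷-injectiveʳ (unique-allSubsets n))
    λ (p , q) → clash (∈-map⁻ _ p) (∈-map⁻ _ q)
    where
    clash : ∀ {I : Subset (suc n)} {xs ys : List (Subset n)} →
      (∃ λ J → J List.∈ xs × I ≡ true ∷ J) →
      ¬ (∃ λ J → J List.∈ ys × I ≡ false ∷ J)
    clash (_ , _ , refl) (_ , _ , ())

  unique⇒length≤ : ∀ {n} {Is : List (Subset n)} → Unique Is →
    length Is ℕ.≤ length (allSubsets n)
  unique⇒length≤ {n} {Is} u = subst (ℕ._≤ _)
    (↭-length (∼bag⇒↭ (unique∧set⇒bag (Unique.filter⁺ (_∈? Is) (unique-allSubsets n)) u
      (mk⇔ (λ I∈ → proj₂ (∈-filter⁻ (_∈? Is) {xs = allSubsets n} I∈))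
           (λ I∈ → ∈-filter⁺ (_∈? Is) (∈-allSubsets _) I∈)))))
    (List.length-filter (_∈? Is) (allSubsets n))
    where open DecMembership (Vec.≡-dec Bool._≟_) using (_∈?_)

  ¬¬-decide : ∀ {A : Set} (P : A → Set) (xs : List A) →
    ¬ ¬ (∀ x → x List.∈ xs → Dec (P x))
  ¬¬-decide P []       k = k λ _ ()
  ¬¬-decide P (x ∷ xs) k = ¬¬-excluded-middle λ p? → ¬¬-decide P xs λ f →
    k λ { _ (here refl) → p? ; y (there y∈) → f y y∈ }

  ¬¬-max : (P : ℕ → Set) (B fuel m : ℕ) → B ℕ.≤ m ℕ.+ fuel → P m →
    (∀ m′ → P m′ → m′ ℕ.≤ B) →
    ¬ ¬ ∃ λ M → P M × (∀ m′ → P m′ → m′ ℕ.≤ M)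
  ¬¬-max P B zero m B≤ pm bd k =
    k (m , pm , λ m′ p → ℕ.≤-trans (bd m′ p) (subst (B ℕ.≤_) (ℕ.+-identityʳ m) B≤))
  ¬¬-max P B (suc d) m B≤ pm bd k = k (m , pm , bounded)
    where
    bounded : ∀ m′ → P m′ → m′ ℕ.≤ m
    bounded m′ p with m′ ℕ.≤? m
    ... | yes m′≤m = m′≤m
    ... | no  m′≰m = contradiction k (¬¬-max P B d m′
      (ℕ.≤-trans B≤ (subst (ℕ._≤ m′ ℕ.+ d) (sym (ℕ.+-suc m d))
        (ℕ.+-monoˡ-≤ d (ℕ.≰⇒> m′≰m))))
      p bd)

  ≢⇒0<∣p-q∣ : ∀ {p q} → p ≢ q → 0ℚ ℚ.< ∣ p ℚ.- q ∣
  ≢⇒0<∣p-q∣ {p} {q} p≢q = ℚ.≰⇒> λ ≤0 → p≢q (x∙y⁻¹≈ε⇒x≈y p q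
    (ℚ.∣p∣≡0⇒p≡0 (p ℚ.- q) (ℚ.≤-antisym ≤0 (ℚ.0≤∣p∣ (p ℚ.- q)))))
    where open import Algebra.Properties.Group ℚ.+-0-group

  fromℚ-injective : ∀ {p q} → fromℚ p ≈ fromℚ q → p ≡ q
  fromℚ-injective {p} {q} p≈q with p ℚ.≟ q
  ... | yes p≡q = p≡q
  ... | no  p≢q with N , h ← _≈_.close p≈q ∣ p ℚ.- q ∣ (≢⇒0<∣p-q∣ p≢q) =
    contradiction (h N ℕ.≤-refl) (ℚ.<-irrefl refl)

  initialNaturals : ∀ n → PointSet n
  initialNaturals n = record
    { point    = λ i → fromℚ (fromℤ (+ toℕ i))
    ; distinct = toℕ-injective ∘ ℤ.+-injective ∘ cong ℚ.↥_ ∘ fromℚ-injective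
    }

¬¬-S-exists : ∀ {n} 𝒫 (V : PointSet n) → ¬ ¬ ∃ λ m → S[ 𝒫 , V ]≡ m
¬¬-S-exists {n} 𝒫 V k = ¬¬-decide (λ I → 𝒫 (V ↾ I)) (allSubsets n) λ dec →
  let 𝒫? = λ I → dec I (∈-allSubsets I) in
  k (_ , filter 𝒫? (allSubsets n) , Unique.filter⁺ 𝒫? (unique-allSubsets n)
    , (λ I → mk⇔ (λ I∈ → proj₂ (∈-filter⁻ 𝒫? {xs = allSubsets n} I∈))
                 (∈-filter⁺ 𝒫? (∈-allSubsets I)))
    , refl)

¬¬-Smax-exists : ∀ 𝒫 n → ¬ ¬ ∃ λ m → Smax[ 𝒫 , n ]≡ m
¬¬-Smax-exists 𝒫 n k = ¬¬-S-exists 𝒫 (initialNaturals n) λ (m , s) →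
  ¬¬-max (λ m → Σ (PointSet n) λ V → S[ 𝒫 , V ]≡ m)
    (length (allSubsets n)) (length (allSubsets n)) m (ℕ.m≤n+m _ m)
    (initialNaturals n , s)
    (λ { m′ (_ , _ , u , _ , refl) → unique⇒length≤ u })
    λ (M , attained , bound) → k (M , attained , λ V m′ s′ → bound m′ (V , s′))

------------------------------------------------------------------------
-- Nonvanishing of the divisors k - 1 and 2k - 2 for k > 1

instance
  k∸1-nonZero : ∀ {k} → .{{NonTrivial k}} → NonZero (k ℕ.∸ 1)
  k∸1-nonZero {suc (suc k)} = _

2k∸2-nonZero : ∀ k → .{{NonTrivial k}} → NonZero (2 ℕ.* k ℕ.∸ 2)
2k∸2-nonZero (suc (suc k)) = ℕ.>-nonZero
  (subst (0 ℕ.<_) (sym (ℕ.+-suc k (suc (k ℕ.+ 0)))) (s≤s z≤n))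

{-# OPTIONS --safe #-}
-- Write K = k - 1 and cut the n points of V, in increasing order, into K
-- consecutive blocks, the first r of size ⌊n / K⌋ + 1 and the others of size
-- ⌊n / K⌋. For every copy x₀ < … < x_K of the pattern in V there is some t such
-- that x_t and x_{t+1} both lie in block t: take the least t for which x_{t+1}
-- comes before the start of block t + 1. A direct similarity preserves the order
-- and is determined by the images of two points, so the pair (x_t, x_{t+1}),
-- whose block reveals t, determines the copy. Hence there are at most as many
-- copies as pairs inside the blocks, which is Σ_{j < n} ⌊j / K⌋ and equals the
-- claimed bound. V and the pattern can be sorted only up to ¬¬, but the
-- conclusion is decidable.
module Submission where

open import Level using (0ℓ)
open import Data.Nat as ℕ using (ℕ; zero; suc; z≤n; NonZero; NonTrivial; _%_; _⊔_)
import Data.Nat.Properties as ℕ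
open import Data.Integer as ℤ using (+_)
import Data.Integer.Properties as ℤ
open import Data.Rational as ℚ using (ℚ; 0ℚ; 1ℚ; ½; ∣_∣; positive; nonNegative)
import Data.Rational.Properties as ℚ
import Data.Rational.Solver as ℚSolver
open import Data.Fin as Fin using (Fin; zero; suc; toℕ; fromℕ; fromℕ<; inject₁; punchOut)
import Data.Fin.Properties as Fin
open import Data.Fin.Subset using (Subset; _∈_; _⊆_) renaming (∣_∣ to card)
open import Data.Fin.Subset.Properties using (∈⊤; ⊆⊤; ∣⊤∣≡n; p⊂q⇒∣p∣<∣q∣; ⊆-antisym)
open import Data.Vec using (tabulate)
open import Data.Vec.Properties using ([]=⇒lookup; lookup⇒[]=; lookup∘tabulate)
open import Data.List using (List; _∷_; length; lookup)
open import Data.List.Membership.Propositional.Properties using (∈-lookup)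
import Data.List.Relation.Unary.All as All
open import Data.List.Relation.Unary.AllPairs using (_∷_)
open import Data.List.Relation.Unary.Unique.Propositional using (Unique)
open import Data.Product using (∃; _×_; _,_; proj₁; proj₂)
open import Data.Sum using (inj₁; inj₂)
open import Effect.Monad using (RawMonad)
open import Function using (_∘_; Injective; Equivalence)
open import Relation.Binary using (Rel; IsStrictTotalOrder; tri<; tri≈; tri>)
open import Relation.Binary.Structures.Biased using (isStrictTotalOrderᶜ)
open import Relation.Binary.PropositionalEquality
open import Relation.Nullary
open import Relation.Nullary.Decidable using (dec-true; decidable-stable; ¬¬-excluded-middle)
open import Relation.Nullary.Negation using (¬¬-Monad)
open import Relation.Unary using (Pred; _≐_) renaming (_⊆_ to _⊆ᵣ_)

-- Pairs in balanced blocks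

module Arithmetic where

  open import Data.Nat using (_+_; _*_; _∸_; _≤_; _<_; _⊓_; _/_)
  open import Data.Nat.DivMod
  open import Data.Nat.Divisibility using (divides-refl)
  open import Data.Nat.Solver using (module +-*-Solver)
  import Data.Integer.Solver as ℤSolver
  import Data.Rational.Unnormalised as ℚᵘ
  import Data.Rational.Unnormalised.Properties as ℚᵘ

  -- A discrete intermediate value argument: the recursion drops the first index as long as `c`
  -- stays at or above `b`, and stops where it first falls below.
  ∃-gap-in-block : ∀ K (c b : Fin (suc K) → ℕ) → b zero ≤ c zero → c (fromℕ K) < b (fromℕ K) →
    ∃ λ (t : Fin K) → b (inject₁ t) ≤ c (inject₁ t) × c (suc t) < b (suc t)
  ∃-gap-in-block zero    c b lo hi = contradiction lo (ℕ.<⇒≱ hi)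
  ∃-gap-in-block (suc K) c b lo hi with ℕ.<-≤-connex (c (suc zero)) (b (suc zero))
  ... | inj₁ below = zero , lo , below
  ... | inj₂ above with t , p ← ∃-gap-in-block K (c ∘ suc) (b ∘ suc) above hi = suc t , p

  prefixSum : (ℕ → ℕ) → ℕ → ℕ
  prefixSum s zero    = 0
  prefixSum s (suc j) = prefixSum s j + s j

  prefixSum-mono : ∀ s {i j} → i ≤ j → prefixSum s i ≤ prefixSum s j
  prefixSum-mono s i≤j with ℕ.≤⇒≤′ i≤j
  ... | i≤′j = go i≤′j
    where
    go : ∀ {i j} → i ℕ.≤′ j → prefixSum s i ≤ prefixSum s j
    go (ℕ.≤′-reflexive refl) = ℕ.≤-refl
    go (ℕ.≤′-step h)         = ℕ.≤-trans (go h) (ℕ.m≤m+n _ _)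

  -- Cells of sizes `s 0`, `s 1`, ... are laid end to end, so that slot `a` of cell `i` has position
  -- `prefixSum s i + a`, which precedes the start of cell `suc i`.
  prefixSum-slot< : ∀ s {i j a} → i < j → a < s i → prefixSum s i + a < prefixSum s j
  prefixSum-slot< s {i} i<j a<si =
    ℕ.<-≤-trans (ℕ.+-monoʳ-< (prefixSum s i) a<si) (prefixSum-mono s i<j)

  prefixSum-slot-injective : ∀ s {i j a b} → a < s i → b < s j →
    prefixSum s i + a ≡ prefixSum s j + b → i ≡ j × a ≡ b
  prefixSum-slot-injective s {i} {j} {a} {b} a< b< eq with ℕ.<-cmp i j
  ... | tri< i<j _ _ = contradiction eq
    (ℕ.<⇒≢ (ℕ.<-≤-trans (prefixSum-slot< s i<j a<) (ℕ.m≤m+n _ b)))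
  ... | tri≈ _ refl _ = refl , ℕ.+-cancelˡ-≡ (prefixSum s i) a b eq
  ... | tri> _ _ j<i = contradiction (sym eq)
    (ℕ.<⇒≢ (ℕ.<-≤-trans (prefixSum-slot< s j<i b<) (ℕ.m≤m+n _ a)))

  module Blocks (K n : ℕ) .{{_ : NonZero K}} where

    q r : ℕ
    q = n / K
    r = n % K

    n≡r+q*K : n ≡ r + q * K
    n≡r+q*K = m≡m%n+[m/n]*n n K

    -- Each earlier block contributes `q` points, and `t ⊓ r` of them contribute one more.
    blockStart : ℕ → ℕ
    blockStart t = t * q + t ⊓ r

    blockStart-K : blockStart K ≡ n
    blockStart-K = begin
      K * q + K ⊓ r  ≡⟨ cong₂ _+_ (ℕ.*-comm K q) (ℕ.m≥n⇒m⊓n≡n (ℕ.<⇒≤ (m%n<n n K))) ⟩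
      q * K + r      ≡⟨ ℕ.+-comm (q * K) r ⟩
      r + q * K      ≡⟨ n≡r+q*K ⟨
      n              ∎
      where open ≡-Reasoning

    -- A pair x < y in block t, at offsets α < β from its start, is sent to
    -- slot α of cell β K + t. That cell has exactly β = ⌊cell / K⌋ slots, so the
    -- pairs lying in a common block inject into Σ_{j < n} ⌊j / K⌋ slots.
    cell : ℕ → ℕ → ℕ
    cell t y = (y ∸ blockStart t) * K + t

    -- A long block, `t < r`, has `q + 1` points, so the offset of `y` is at most `q` and the cell
    -- at most `q * K + t`, below `q * K + r`. In a short block the offset is below `q`, which puts
    -- the cell below `q * K`.
    cell<n : ∀ {t y} → t < K → blockStart t ≤ y → y < blockStart (suc t) → cell t y < n
    cell<n {t} {y} t<K lo hi with ℕ.<-≤-connex t r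
    ... | inj₁ t<r = begin-strict
      (y ∸ blockStart t) * K + t  ≤⟨ ℕ.+-monoˡ-≤ t (ℕ.*-monoˡ-≤ K β≤q) ⟩
      q * K + t                   <⟨ ℕ.+-monoʳ-< (q * K) t<r ⟩
      q * K + r                   ≡⟨ ℕ.+-comm (q * K) r ⟩
      r + q * K                   ≡⟨ n≡r+q*K ⟨
      n                           ∎
      where
      open ℕ.≤-Reasoning
      β≤q : y ∸ blockStart t ≤ q
      β≤q = ℕ.m≤n+o⇒m∸n≤o y (blockStart t) (ℕ.s≤s⁻¹ (begin
        suc y                              ≤⟨ hi ⟩
        q + t * q + suc t ⊓ r
          ≡⟨ cong (λ m → q + t * q + m) (ℕ.m≤n⇒m⊓n≡m t<r) ⟩
        q + t * q + suc t
          ≡⟨ solve 3 (λ q a t → q :+ a :+ (con 1 :+ t)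
               := con 1 :+ (a :+ t :+ q)) refl q (t * q) t ⟩
        suc (t * q + t + q)
          ≡⟨ cong (λ m → suc (t * q + m + q)) (ℕ.m≤n⇒m⊓n≡m (ℕ.<⇒≤ t<r)) ⟨
        suc (blockStart t + q)             ∎))
        where open +-*-Solver
    ... | inj₂ r≤t = begin-strict
      (y ∸ blockStart t) * K + t  <⟨ ℕ.+-monoʳ-< ((y ∸ blockStart t) * K) t<K ⟩
      (y ∸ blockStart t) * K + K  ≡⟨ ℕ.+-comm ((y ∸ blockStart t) * K) K ⟩
      suc (y ∸ blockStart t) * K  ≤⟨ ℕ.*-monoˡ-≤ K β<q ⟩
      q * K                       ≤⟨ ℕ.m≤n+m (q * K) r ⟩
      r + q * K                   ≡⟨ n≡r+q*K ⟨
      n                           ∎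
      where
      open ℕ.≤-Reasoning
      β<q : suc (y ∸ blockStart t) ≤ q
      β<q = subst (_≤ q) (ℕ.+-∸-assoc 1 lo) (ℕ.m≤n+o⇒m∸n≤o (suc y) (blockStart t) (begin
        suc y                     ≤⟨ hi ⟩
        q + t * q + suc t ⊓ r
          ≡⟨ cong (λ m → q + t * q + m) (ℕ.m≥n⇒m⊓n≡n (ℕ.m≤n⇒m≤1+n r≤t)) ⟩
        q + t * q + r
          ≡⟨ solve 3 (λ q a r → q :+ a :+ r := a :+ r :+ q) refl q (t * q) r ⟩
        t * q + r + q             ≡⟨ cong (λ m → t * q + m + q) (ℕ.m≥n⇒m⊓n≡n r≤t) ⟨
        blockStart t + q          ∎))
        where open +-*-Solver

    cell%K : ∀ {t} y → t < K → cell t y % K ≡ t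
    cell%K {t} y t<K = begin
      ((y ∸ blockStart t) * K + t) % K  ≡⟨ cong (_% K) (ℕ.+-comm _ t) ⟩
      (t + (y ∸ blockStart t) * K) % K  ≡⟨ [m+kn]%n≡m%n t (y ∸ blockStart t) K ⟩
      t % K                             ≡⟨ m<n⇒m%n≡m t<K ⟩
      t                                 ∎
      where open ≡-Reasoning

    cell/K : ∀ {t} y → t < K → cell t y / K ≡ y ∸ blockStart t
    cell/K {t} y t<K = begin
      ((y ∸ blockStart t) * K + t) / K
        ≡⟨ +-distrib-/-∣ˡ t (divides-refl (y ∸ blockStart t)) ⟩
      (y ∸ blockStart t) * K / K + t / K
        ≡⟨ cong₂ _+_ (m*n/n≡m (y ∸ blockStart t) K) (m<n⇒m/n≡0 t<K) ⟩
      y ∸ blockStart t + 0                     ≡⟨ ℕ.+-identityʳ _ ⟩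
      y ∸ blockStart t                         ∎
      where open ≡-Reasoning

    record InBlock (t x y : ℕ) : Set where
      constructor inBlock
      field
        t<K : t < K
        lo  : blockStart t ≤ x
        x<y : x < y
        hi  : y < blockStart (suc t)

    code : ℕ → ℕ → ℕ → ℕ
    code t x y = prefixSum (_/ K) (cell t y) + (x ∸ blockStart t)

    private
      slot : ∀ {t x y} → InBlock t x y → x ∸ blockStart t < cell t y / K
      slot {y = y} (inBlock t<K lo x<y hi) =
        subst (λ m → _ < m) (sym (cell/K y t<K)) (ℕ.∸-monoˡ-< x<y lo)

    code< : ∀ {t x y} → InBlock t x y → code t x y < prefixSum (_/ K) n
    code< p@(inBlock t<K lo x<y hi) =
      prefixSum-slot< (_/ K) (cell<n t<K (ℕ.≤-trans lo (ℕ.<⇒≤ x<y)) hi) (slot p)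

    code-injective : ∀ {t x y t′ x′ y′} → InBlock t x y → InBlock t′ x′ y′ →
      code t x y ≡ code t′ x′ y′ → t ≡ t′ × x ≡ x′ × y ≡ y′
    code-injective {y = y} {y′ = y′} p@(inBlock t<K lo x<y _) p′@(inBlock t′<K lo′ x′<y′ _) eq
      with j≡ , x≡ ← prefixSum-slot-injective (_/ K) (slot p) (slot p′) eq
      -- Remainders modulo `K` identify the blocks first; only then are both offsets measured from
      -- the same start, where truncated subtraction cancels.
      with refl ← trans (sym (cell%K y t<K)) (trans (cong (_% K) j≡) (cell%K y′ t′<K))
      = refl , ℕ.∸-cancelʳ-≡ lo lo′ x≡ , ℕ.∸-cancelʳ-≡
          (ℕ.≤-trans lo (ℕ.<⇒≤ x<y)) (ℕ.≤-trans lo′ (ℕ.<⇒≤ x′<y′))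
          (trans (sym (cell/K y t<K)) (trans (cong (_/ K) j≡) (cell/K y′ t′<K)))

  -- The combinatorial core, with `p i t` the rank in `V` of the `t`-th smallest point of copy `i`.
  -- The last hypothesis compares two copies at a common `t`; this suffices because the code of a
  -- pair reveals `t`.
  increasing-sequences≤ : ∀ {m K n} .{{_ : NonZero K}} (p : Fin m → Fin (suc K) → ℕ) →
    (∀ i t → p i t < n) →
    (∀ i t → p i (inject₁ t) < p i (suc t)) →
    (∀ i j t → p i (inject₁ t) ≡ p j (inject₁ t) → p i (suc t) ≡ p j (suc t) → i ≡ j) →
    m ≤ prefixSum (_/ K) n
  increasing-sequences≤ {m} {K} {n} p p<n p-increasing p-injective =
    Fin.injective⇒≤ {f = codeOf} λ {i} {j} eq → agree i j (gap i) (gap j)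
      (Fin.fromℕ<-injective _ _ (code< (proj₂ (gap i))) (code< (proj₂ (gap j))) eq)
    where
    open Blocks K n

    Gap : Fin m → Set
    Gap i = ∃ λ (t : Fin K) → InBlock (toℕ t) (p i (inject₁ t)) (p i (suc t))

    gap : ∀ i → Gap i
    gap i =
      -- Block `0` starts at `0`, and the last block ends at `n`, above every rank; these are the
      -- two end conditions.
      let t , lo , hi = ∃-gap-in-block K (p i) (blockStart ∘ toℕ) z≤n
            (subst (p i (fromℕ K) <_)
              (sym (trans (cong blockStart (Fin.toℕ-fromℕ K)) blockStart-K)) (p<n i (fromℕ K)))
      in t , inBlock (Fin.toℕ<n t)
        (subst (λ u → blockStart u ≤ p i (inject₁ t)) (Fin.toℕ-inject₁ t) lo)
        (p-increasing i t) hi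

    codeOf : Fin m → Fin (prefixSum (_/ K) n)
    codeOf i = Fin.fromℕ< (code< (proj₂ (gap i)))

    -- The gaps are arguments so that `t` and `u` are variables, which the equality of blocks can
    -- unify.
    agree : ∀ i j ((t , _) : Gap i) ((u , _) : Gap j) →
      code (toℕ t) (p i (inject₁ t)) (p i (suc t)) ≡ code (toℕ u) (p j (inject₁ u)) (p j (suc u)) →
      i ≡ j
    agree i j (t , a) (u , b) eq with t≡u , x≡ , y≡ ← code-injective a b eq
      with refl ← Fin.toℕ-injective t≡u = p-injective i j t x≡ y≡

  -- Closed form of the sum of quotients

  [r+q*K]/K≡q : ∀ q {r K} .{{_ : NonZero K}} → r < K → (r + q * K) / K ≡ q
  [r+q*K]/K≡q q {r} {K} r<K = begin
    (r + q * K) / K        ≡⟨ +-distrib-/-∣ʳ r (divides-refl q) ⟩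
    r / K + q * K / K      ≡⟨ cong₂ _+_ (m<n⇒m/n≡0 r<K) (m*n/n≡m q K) ⟩
    q                      ∎
    where open ≡-Reasoning

  -- This is 2 Σ = K q (q - 1) + 2 r q, freed of the subtraction.
  prefixSum-quotients : ∀ K .{{_ : NonZero K}} q r → r ≤ K →
    2 * prefixSum (_/ K) (r + q * K) + q * K ≡ K * q * q + 2 * r * q
  prefixSum-quotients K zero zero _ =
    solve 1 (λ K → con 0 := K :* con 0 :* con 0 :+ con 0) refl K
    where open +-*-Solver
  -- Remainder `0` over `suc q` is remainder `K` over `q`; hence the hypothesis `r ≤ K` in place of
  -- `r < K`.
  prefixSum-quotients K (suc q) zero _ = begin
    2 * S + (K + q * K)
      ≡⟨ solve 3 (λ S K q → con 2 :* S :+ (K :+ q :* K)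
           := K :+ (con 2 :* S :+ q :* K)) refl S K q ⟩
    K + (2 * S + q * K)
      ≡⟨ cong (λ m → K + m) (prefixSum-quotients K q K ℕ.≤-refl) ⟩
    K + (K * q * q + 2 * K * q)
      ≡⟨ solve 2 (λ K q → K :+ (K :* q :* q :+ con 2 :* K :* q)
           := K :* (con 1 :+ q) :* (con 1 :+ q) :+ con 0) refl K q ⟩
    K * suc q * suc q + 0            ∎
    where
    open ≡-Reasoning
    open +-*-Solver
    S = prefixSum (_/ K) (K + q * K)
  prefixSum-quotients K q (suc r) r<K = begin
    2 * (S + (r + q * K) / K) + q * K
      ≡⟨ cong (λ d → 2 * (S + d) + q * K) ([r+q*K]/K≡q q r<K) ⟩
    2 * (S + q) + q * K
      ≡⟨ solve 3 (λ S q K → con 2 :* (S :+ q) :+ q :* K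
           := con 2 :* S :+ q :* K :+ con 2 :* q) refl S q K ⟩
    2 * S + q * K + 2 * q
      ≡⟨ cong (_+ 2 * q) (prefixSum-quotients K q r (ℕ.<⇒≤ r<K)) ⟩
    K * q * q + 2 * r * q + 2 * q
      ≡⟨ solve 3 (λ K q r → K :* q :* q :+ con 2 :* r :* q :+ con 2 :* q
           := K :* q :* q :+ con 2 :* (con 1 :+ r) :* q) refl K q r ⟩
    K * q * q + 2 * suc r * q           ∎
    where
    open ≡-Reasoning
    open +-*-Solver
    S = prefixSum (_/ K) (r + q * K)

  -- Substituting `n = r + q * K` turns the factors into `q * K` and `q * K + 2 * r - K`. Their
  -- product is `K` times the value of `2 * S` given by `prefixSum-quotients`. The second factor can
  -- be negative, hence the integers.
  bound-numerator : ∀ K n .{{_ : NonZero K}} → let r = n % K in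
    (+ n ℤ.- + r) ℤ.* (+ n ℤ.+ + r ℤ.- + suc K ℤ.+ + 1) ≡ + (prefixSum (_/ K) n * (2 * suc K ∸ 2))
  bound-numerator K n = begin
    (+ n ℤ.- + r) ℤ.* (+ n ℤ.+ + r ℤ.- + suc K ℤ.+ + 1)
      ≡⟨ cong (λ n → (n ℤ.- + r) ℤ.* (n ℤ.+ + r ℤ.- + suc K ℤ.+ + 1)) +n ⟩
    (+ r ℤ.+ + q ℤ.* + K ℤ.- + r) ℤ.* (+ r ℤ.+ + q ℤ.* + K ℤ.+ + r ℤ.- (+ 1 ℤ.+ + K) ℤ.+ + 1)
      ≡⟨ solve 3 (λ r q K → (r :+ q :* K :- r) :* (r :+ q :* K :+ r :- (con (+ 1) :+ K) :+ con (+ 1))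
           := K :* (K :* q :* q :+ con (+ 2) :* r :* q :- q :* K)) refl (+ r) (+ q) (+ K) ⟩
    + K ℤ.* (+ K ℤ.* + q ℤ.* + q ℤ.+ + 2 ℤ.* + r ℤ.* + q ℤ.- + q ℤ.* + K)
      ≡⟨ cong (λ p → + K ℤ.* (p ℤ.- + q ℤ.* + K)) +sum ⟨
    + K ℤ.* (+ 2 ℤ.* + S ℤ.+ + q ℤ.* + K ℤ.- + q ℤ.* + K)
      ≡⟨ solve 3 (λ S q K → K :* (con (+ 2) :* S :+ q :* K :- q :* K) := S :* (con (+ 2) :* K))
           refl (+ S) (+ q) (+ K) ⟩
    + S ℤ.* (+ 2 ℤ.* + K)
      ≡⟨ trans (cong (λ p → + S ℤ.* p) (sym (ℤ.pos-* 2 K))) (sym (ℤ.pos-* S (2 * K))) ⟩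
    + (S * (2 * K))
      ≡⟨ cong (λ d → + (S * (d ∸ 2))) (ℕ.*-suc 2 K) ⟨
    + (S * (2 * suc K ∸ 2)) ∎
    where
    open ≡-Reasoning
    open ℤSolver.+-*-Solver
    q = n / K
    r = n % K
    S = prefixSum (_/ K) n
    +n : + n ≡ + r ℤ.+ + q ℤ.* + K
    +n = begin
      + n                    ≡⟨ cong +_ (m≡m%n+[m/n]*n n K) ⟩
      + (r + q * K)          ≡⟨ cong (ℤ._+_ (+ r)) (ℤ.pos-* q K) ⟩
      + r ℤ.+ + q ℤ.* + K    ∎
    +sum : + 2 ℤ.* + S ℤ.+ + q ℤ.* + K ≡ + K ℤ.* + q ℤ.* + q ℤ.+ + 2 ℤ.* + r ℤ.* + q
    +sum = begin
      + 2 ℤ.* + S ℤ.+ + q ℤ.* + K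
        ≡⟨ cong₂ ℤ._+_ (ℤ.pos-* 2 S) (ℤ.pos-* q K) ⟨
      + (2 * S + q * K)
        ≡⟨ cong (λ n → + (2 * prefixSum (_/ K) n + q * K)) (m≡m%n+[m/n]*n n K) ⟩
      + (2 * prefixSum (_/ K) (r + q * K) + q * K)
        ≡⟨ cong +_ (prefixSum-quotients K q r (ℕ.<⇒≤ (m%n<n n K))) ⟩
      + (K * q * q + 2 * r * q)
        ≡⟨ cong₂ ℤ._+_
             (trans (ℤ.pos-* (K * q) q) (cong (ℤ._* + q) (ℤ.pos-* K q)))
             (trans (ℤ.pos-* (2 * r) q) (cong (ℤ._* + q) (ℤ.pos-* 2 r))) ⟩
      + K ℤ.* + q ℤ.* + q ℤ.+ + 2 ℤ.* + r ℤ.* + q ∎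

  -- Cross multiplication, carried out on unnormalised fractions because `ℚ._/_` reduces to lowest
  -- terms.
  m≤s⇒m/1≤s*d/d : ∀ {m s} d .{{_ : NonZero d}} → m ≤ s → (+ m ℚ./ 1) ℚ.≤ (+ (s * d) ℚ./ d)
  m≤s⇒m/1≤s*d/d {m} {s} (suc d-1) m≤s = ℚ.toℚᵘ-cancel-≤ (begin
    ℚ.toℚᵘ (+ m ℚ./ 1)               ≃⟨ ℚ.toℚᵘ-fromℚᵘ (ℚᵘ.mkℚᵘ (+ m) 0) ⟩
    ℚᵘ.mkℚᵘ (+ m) 0                  ≤⟨ ℚᵘ.*≤* (subst₂ ℤ._≤_
      (ℤ.pos-* m (suc d-1)) (sym (ℤ.*-identityʳ _)) (ℤ.+≤+ (ℕ.*-monoˡ-≤ (suc d-1) m≤s))) ⟩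
    ℚᵘ.mkℚᵘ (+ (s * suc d-1)) d-1    ≃⟨ ℚ.toℚᵘ-fromℚᵘ (ℚᵘ.mkℚᵘ (+ (s * suc d-1)) d-1) ⟨
    ℚ.toℚᵘ (+ (s * suc d-1) ℚ./ suc d-1) ∎)
    where open ℚᵘ.≤-Reasoning

open Arithmetic using (prefixSum; increasing-sequences≤; bound-numerator; m≤s⇒m/1≤s*d/d)

-- Ranks in a finite total order

-- Pigeonhole: punching a missed value out of the codomain would inject `Fin (suc n)` into `Fin n`.
injective⇒surjective : ∀ {n} {f : Fin n → Fin n} → Injective _≡_ _≡_ f → ∀ y → ∃ λ x → f x ≡ y
injective⇒surjective {suc n} {f} f-inj y with Fin.any? (λ x → f x Fin.≟ y)
... | yes y∈im = y∈im
... | no  y∉im = contradiction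
  (Fin.injective⇒≤ {f = λ x → punchOut (avoids x)}
    λ eq → f-inj (Fin.punchOut-injective (avoids _) (avoids _) eq))
  ℕ.1+n≰n
  where
  avoids : ∀ x → y ≢ f x
  avoids x y≡fx = y∉im (x , sym y≡fx)

module Rank {n} {_≺_ : Rel (Fin n) 0ℓ} (sto : IsStrictTotalOrder _≡_ _≺_) where

  private
    module ≺ = IsStrictTotalOrder sto

  below : Fin n → Subset n
  below i = tabulate λ j → does (j ≺.<? i)

  ∈-below⁺ : ∀ {i j} → j ≺ i → j ∈ below i
  ∈-below⁺ {i} {j} j≺i =
    lookup⇒[]= j _ (trans (lookup∘tabulate _ j) (dec-true (j ≺.<? i) j≺i))

  ∈-below⁻ : ∀ {i j} → j ∈ below i → j ≺ i
  ∈-below⁻ {i} {j} j∈ with j ≺.<? i | trans (sym (lookup∘tabulate _ j)) ([]=⇒lookup j∈)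
  ... | yes j≺i | _ = j≺i

  card-below<n : ∀ i → card (below i) ℕ.< n
  card-below<n i = subst (card (below i) ℕ.<_) (∣⊤∣≡n n)
    (p⊂q⇒∣p∣<∣q∣ (⊆⊤ , i , ∈⊤ , λ i∈ → ≺.irrefl refl (∈-below⁻ i∈)))

  rank : Fin n → Fin n
  rank i = fromℕ< (card-below<n i)

  rank-mono : ∀ {i j} → i ≺ j → toℕ (rank i) ℕ.< toℕ (rank j)
  rank-mono {i} {j} i≺j =
    subst₂ ℕ._<_ (sym (Fin.toℕ-fromℕ< (card-below<n i))) (sym (Fin.toℕ-fromℕ< (card-below<n j)))
      (p⊂q⇒∣p∣<∣q∣ ( (λ l∈ → ∈-below⁺ (≺.trans (∈-below⁻ l∈) i≺j))
                   , i , ∈-below⁺ i≺j , λ i∈ → ≺.irrefl refl (∈-below⁻ i∈)))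

  rank-injective : Injective _≡_ _≡_ rank
  rank-injective {i} {j} eq with ≺.compare i j
  ... | tri< i≺j _ _ = contradiction (cong toℕ eq) (ℕ.<⇒≢ (rank-mono i≺j))
  ... | tri≈ _ i≡j _ = i≡j
  ... | tri> _ _ j≺i = contradiction (cong toℕ (sym eq)) (ℕ.<⇒≢ (rank-mono j≺i))

  -- The inverse of `rank`, which lists the elements in increasing order; it serves to sort the
  -- pattern.
  nth : Fin n → Fin n
  nth t = proj₁ (injective⇒surjective rank-injective t)

  rank-nth : ∀ t → rank (nth t) ≡ t
  rank-nth t = proj₂ (injective⇒surjective rank-injective t)

  nth-mono : ∀ {s t} → toℕ s ℕ.< toℕ t → nth s ≺ nth t
  nth-mono {s} {t} s<t with ≺.compare (nth s) (nth t)
  ... | tri< lt _ _ = lt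
  ... | tri≈ _ eq _ = contradiction
    (cong toℕ (trans (sym (rank-nth s)) (trans (cong rank eq) (rank-nth t)))) (ℕ.<⇒≢ s<t)
  ... | tri> _ _ gt = contradiction
    (subst₂ (λ a b → toℕ a ℕ.< toℕ b) (rank-nth t) (rank-nth s) (rank-mono gt)) (ℕ.<⇒≯ s<t)

-- Cauchy reals and direct similarities

open import Defs
open ℚSolver.+-*-Solver using (solve; _:=_; _:+_; _:*_; _:-_; :-_)

-- Convergence to `0`. The field of `x ≈ y` is `Null` of the difference, so `null-cong` derives
-- equivalences from polynomial identities.
Null : (ℕ → ℚ) → Set
Null s = ∀ ε → 0ℚ ℚ.< ε → ∃ λ N → ∀ n → N ℕ.≤ n → ∣ s n ∣ ℚ.< ε

half : ∀ {ε} → 0ℚ ℚ.< ε → ∃ λ δ → 0ℚ ℚ.< δ × δ ℚ.+ δ ≡ ε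
half {ε} 0<ε = ½ ℚ.* ε
  , ℚ.positive⁻¹ _ {{ℚ.pos*pos⇒pos ½ ε {{positive 0<ε}}}}
  , trans (sym (ℚ.*-distribʳ-+ ε ½ ½)) (ℚ.*-identityˡ ε)

*-pos : ∀ {p q} → 0ℚ ℚ.< p → 0ℚ ℚ.< q → 0ℚ ℚ.< p ℚ.* q
*-pos {p} {q} 0<p 0<q = ℚ.positive⁻¹ _ {{ℚ.pos*pos⇒pos p {{positive 0<p}} q {{positive 0<q}}}}

p≤∣p∣ : ∀ p → p ℚ.≤ ∣ p ∣
p≤∣p∣ p with ℚ.≤-total 0ℚ p
... | inj₁ 0≤p = ℚ.≤-reflexive (sym (ℚ.0≤p⇒∣p∣≡p 0≤p))
... | inj₂ p≤0 = ℚ.≤-trans p≤0 (ℚ.0≤∣p∣ p)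

∣p-q∣≡∣q-p∣ : ∀ p q → ∣ p ℚ.- q ∣ ≡ ∣ q ℚ.- p ∣
∣p-q∣≡∣q-p∣ p q = trans (cong ∣_∣ (solve 2 (λ p q → p :- q := :- (q :- p)) refl p q))
                        (ℚ.∣-p∣≡∣p∣ (q ℚ.- p))

∣p-q∣<ε⇒p<q+ε : ∀ p q {ε} → ∣ p ℚ.- q ∣ ℚ.< ε → p ℚ.< q ℚ.+ ε
∣p-q∣<ε⇒p<q+ε p q {ε} h = begin-strict
  p                      ≡⟨ solve 2 (λ p q → p := q :+ (p :- q)) refl p q ⟩
  q ℚ.+ (p ℚ.- q)        ≤⟨ ℚ.+-monoʳ-≤ q (p≤∣p∣ (p ℚ.- q)) ⟩
  q ℚ.+ ∣ p ℚ.- q ∣      <⟨ ℚ.+-monoʳ-< q h ⟩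
  q ℚ.+ ε                ∎
  where open ℚ.≤-Reasoning

∣p-q∣<ε⇒q<p+ε : ∀ p q {ε} → ∣ p ℚ.- q ∣ ℚ.< ε → q ℚ.< p ℚ.+ ε
∣p-q∣<ε⇒q<p+ε p q h = ∣p-q∣<ε⇒p<q+ε q p (subst (ℚ._< _) (∣p-q∣≡∣q-p∣ p q) h)

p<q+ε⇒q<p+ε⇒∣p-q∣<ε : ∀ p q {ε} → p ℚ.< q ℚ.+ ε → q ℚ.< p ℚ.+ ε → ∣ p ℚ.- q ∣ ℚ.< ε
p<q+ε⇒q<p+ε⇒∣p-q∣<ε p q {ε} p< q< with ℚ.∣p∣≡p∨∣p∣≡-p (p ℚ.- q)
... | inj₁ eq = subst (ℚ._< ε) (sym eq) (subst₂ ℚ._<_ refl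
  (solve 2 (λ q ε → q :+ ε :- q := ε) refl q ε) (ℚ.+-monoˡ-< (ℚ.- q) p<))
... | inj₂ eq = subst (ℚ._< ε) (sym eq) (subst₂ ℚ._<_
  (solve 2 (λ p q → q :- p := :- (p :- q)) refl p q)
  (solve 2 (λ p ε → p :+ ε :- p := ε) refl p ε) (ℚ.+-monoˡ-< (ℚ.- p) q<))

+-cancelʳ-< : ∀ r {p q} → p ℚ.+ r ℚ.< q ℚ.+ r → p ℚ.< q
+-cancelʳ-< r {p} {q} h = subst₂ ℚ._<_ (cancel p) (cancel q) (ℚ.+-monoˡ-< (ℚ.- r) h)
  where
  cancel : ∀ p → p ℚ.+ r ℚ.- r ≡ p
  cancel p = solve 2 (λ p r → p :+ r :- r := p) refl p r

null-cong : ∀ {s t} → (∀ n → s n ≡ t n) → Null s → Null t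
null-cong s≗t s0 ε 0<ε with N , h ← s0 ε 0<ε =
  N , λ n n≥ → subst (λ q → ∣ q ∣ ℚ.< ε) (s≗t n) (h n n≥)

null-+ : ∀ {s t} → Null s → Null t → Null (λ n → s n ℚ.+ t n)
null-+ {s} {t} s0 t0 ε 0<ε with δ , 0<δ , δ+δ≡ε ← half 0<ε
  with M , hs ← s0 δ 0<δ | N , ht ← t0 δ 0<δ =
  M ⊔ N , λ n n≥ → begin-strict
    ∣ s n ℚ.+ t n ∣         ≤⟨ ℚ.∣p+q∣≤∣p∣+∣q∣ (s n) (t n) ⟩
    ∣ s n ∣ ℚ.+ ∣ t n ∣
      <⟨ ℚ.+-mono-< (hs n (ℕ.m⊔n≤o⇒m≤o M N n≥)) (ht n (ℕ.m⊔n≤o⇒n≤o M N n≥)) ⟩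
    δ ℚ.+ δ                 ≡⟨ δ+δ≡ε ⟩
    ε ∎
  where open ℚ.≤-Reasoning

null-neg : ∀ {s} → Null s → Null (λ n → ℚ.- s n)
null-neg {s} s0 ε 0<ε with N , h ← s0 ε 0<ε =
  N , λ n n≥ → subst (ℚ._< ε) (sym (ℚ.∣-p∣≡∣p∣ (s n))) (h n n≥)

null-- : ∀ {s t} → Null s → Null t → Null (λ n → s n ℚ.- t n)
null-- s0 t0 = null-+ s0 (null-neg t0)

cauchy⇒bounded : ∀ x → ∃ λ B → 0ℚ ℚ.< B × ∃ λ N → ∀ n → N ℕ.≤ n → ∣ seq x n ∣ ℚ.< B
cauchy⇒bounded x with N , h ← cauchy x 1ℚ (ℚ.positive⁻¹ 1ℚ)
  = 1ℚ ℚ.+ ∣ seq x N ∣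
  , ℚ.+-mono-<-≤ (ℚ.positive⁻¹ 1ℚ) (ℚ.0≤∣p∣ (seq x N))
  , N , λ n n≥ → begin-strict
    ∣ seq x n ∣
      ≡⟨ cong ∣_∣ (solve 2 (λ a b → a := (a :- b) :+ b) refl (seq x n) (seq x N)) ⟩
    ∣ (seq x n ℚ.- seq x N) ℚ.+ seq x N ∣
      ≤⟨ ℚ.∣p+q∣≤∣p∣+∣q∣ (seq x n ℚ.- seq x N) (seq x N) ⟩
    ∣ seq x n ℚ.- seq x N ∣ ℚ.+ ∣ seq x N ∣
      <⟨ ℚ.+-monoˡ-< ∣ seq x N ∣ (h n N n≥ ℕ.≤-refl) ⟩
    1ℚ ℚ.+ ∣ seq x N ∣ ∎
  where open ℚ.≤-Reasoning

private
  divide : ∀ {B ε} → 0ℚ ℚ.< B → 0ℚ ℚ.< ε → ∃ λ δ → 0ℚ ℚ.< δ × B ℚ.* δ ≡ ε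
  divide {B} {ε} 0<B 0<ε = ℚ.1/_ B {{nz}} ℚ.* ε
    , *-pos (ℚ.positive⁻¹ (ℚ.1/_ B {{nz}}) {{ℚ.1/pos⇒pos B {{positive 0<B}}}}) 0<ε
    , trans (sym (ℚ.*-assoc B (ℚ.1/_ B {{nz}}) ε))
        (trans (cong (ℚ._* ε) (ℚ.*-inverseʳ B {{nz}})) (ℚ.*-identityˡ ε))
    where
    nz = ℚ.pos⇒nonZero B {{positive 0<B}}

null-*ˡ : ∀ x {s} → Null s → Null (λ n → seq x n ℚ.* s n)
null-*ˡ x {s} s0 ε 0<ε =
  let B , 0<B , M , x<B = cauchy⇒bounded x
      δ , 0<δ , Bδ≡ε = divide 0<B 0<ε
      N , h = s0 δ 0<δ
  in M ⊔ N , λ n n≥ → begin-strict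
    ∣ seq x n ℚ.* s n ∣        ≡⟨ ℚ.∣p*q∣≡∣p∣*∣q∣ (seq x n) (s n) ⟩
    ∣ seq x n ∣ ℚ.* ∣ s n ∣
      ≤⟨ ℚ.*-monoʳ-≤-nonNeg ∣ s n ∣ {{nonNegative (ℚ.0≤∣p∣ (s n))}}
           (ℚ.<⇒≤ (x<B n (ℕ.m⊔n≤o⇒m≤o M N n≥))) ⟩
    B ℚ.* ∣ s n ∣
      <⟨ ℚ.*-monoʳ-<-pos B {{positive 0<B}} (h n (ℕ.m⊔n≤o⇒n≤o M N n≥)) ⟩
    B ℚ.* δ                    ≡⟨ Bδ≡ε ⟩
    ε ∎
  where open ℚ.≤-Reasoning

-- Replaces division by a positive real: where `c n` exceeds `δ`, having `∣ s n ∣` at least `ε`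
-- would make the product at least `δ * ε` in absolute value.
null-*-cancel : ∀ {δ N} (c : ℕ → ℚ) {s : ℕ → ℚ} → 0ℚ ℚ.< δ → (∀ n → N ℕ.≤ n → δ ℚ.< c n) →
  Null (λ n → c n ℚ.* s n) → Null s
null-*-cancel {δ} {M} c {s} 0<δ δ<c cs0 ε 0<ε with N , h ← cs0 (δ ℚ.* ε) (*-pos 0<δ 0<ε) =
  M ⊔ N , λ n n≥ → ℚ.≰⇒> λ ε≤∣s∣ → ℚ.<-irrefl refl (begin-strict
    δ ℚ.* ε                    ≤⟨ ℚ.*-monoˡ-≤-nonNeg δ {{nonNegative (ℚ.<⇒≤ 0<δ)}} ε≤∣s∣ ⟩
    δ ℚ.* ∣ s n ∣
      ≤⟨ ℚ.*-monoʳ-≤-nonNeg ∣ s n ∣ {{nonNegative (ℚ.0≤∣p∣ (s n))}}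
           (ℚ.≤-trans (ℚ.<⇒≤ (δ<c n (ℕ.m⊔n≤o⇒m≤o M N n≥))) (p≤∣p∣ (c n))) ⟩
    ∣ c n ∣ ℚ.* ∣ s n ∣        ≡⟨ ℚ.∣p*q∣≡∣p∣*∣q∣ (c n) (s n) ⟨
    ∣ c n ℚ.* s n ∣            <⟨ h n (ℕ.m⊔n≤o⇒n≤o M N n≥) ⟩
    δ ℚ.* ε ∎)
  where open ℚ.≤-Reasoning

-- Equivalence, strict order and affine maps

≈-refl : ∀ {x} → x ≈ x
≈-refl {x} = mk≈ λ ε 0<ε → 0 , λ n _ →
  subst (ℚ._< ε) (sym (cong ∣_∣ (ℚ.+-inverseʳ (seq x n)))) 0<ε

≈-sym : ∀ {x y} → x ≈ y → y ≈ x
≈-sym {x} {y} (mk≈ h) = mk≈ (null-cong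
  (λ n → solve 2 (λ x y → :- (x :- y) := y :- x) refl (seq x n) (seq y n)) (null-neg h))

≈-trans : ∀ {x y z} → x ≈ y → y ≈ z → x ≈ z
≈-trans {x} {y} {z} (mk≈ h) (mk≈ k) = mk≈ (null-cong
  (λ n → solve 3 (λ x y z → (x :- y) :+ (y :- z) := x :- z) refl (seq x n) (seq y n) (seq z n))
  (null-+ h k))

<-irrefl : ∀ {x} → ¬ x < x
<-irrefl {x} (mk< ε 0<ε N h) = ℚ.<-irrefl refl (ℚ.<-trans
  (subst (ℚ._< seq x N ℚ.+ ε) (ℚ.+-identityʳ (seq x N)) (ℚ.+-monoʳ-< (seq x N) 0<ε))
  (h N ℕ.≤-refl))

<-trans : ∀ {x y z} → x < y → y < z → x < z
<-trans {x} {y} {z} (mk< ε 0<ε M hx) (mk< δ 0<δ N hy) = mk< ε 0<ε (M ⊔ N) λ n n≥ → begin-strict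
  seq x n ℚ.+ ε  <⟨ hx n (ℕ.m⊔n≤o⇒m≤o M N n≥) ⟩
  seq y n        ≡⟨ ℚ.+-identityʳ (seq y n) ⟨
  seq y n ℚ.+ 0ℚ <⟨ ℚ.+-monoʳ-< (seq y n) 0<δ ⟩
  seq y n ℚ.+ δ  <⟨ hy n (ℕ.m⊔n≤o⇒n≤o M N n≥) ⟩
  seq z n        ∎
  where open ℚ.≤-Reasoning

-- One half of the gap `ε` absorbs the eventual distance from `y` to `z`; the other half is the new
-- gap.
<-respʳ-≈ : ∀ {x y z} → y ≈ z → x < y → x < z
<-respʳ-≈ {x} {y} {z} (mk≈ y≈z) (mk< ε 0<ε M h) with δ , 0<δ , δ+δ≡ε ← half 0<ε
  with N , k ← y≈z δ 0<δ =
  mk< δ 0<δ (M ⊔ N) λ n n≥ → +-cancelʳ-< δ (begin-strict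
    seq x n ℚ.+ δ ℚ.+ δ      ≡⟨ ℚ.+-assoc (seq x n) δ δ ⟩
    seq x n ℚ.+ (δ ℚ.+ δ)    ≡⟨ cong (seq x n ℚ.+_) δ+δ≡ε ⟩
    seq x n ℚ.+ ε            <⟨ h n (ℕ.m⊔n≤o⇒m≤o M N n≥) ⟩
    seq y n                  <⟨ ∣p-q∣<ε⇒p<q+ε (seq y n) (seq z n) (k n (ℕ.m⊔n≤o⇒n≤o M N n≥)) ⟩
    seq z n ℚ.+ δ            ∎)
  where open ℚ.≤-Reasoning

<-respˡ-≈ : ∀ {x y z} → x ≈ z → x < y → z < y
<-respˡ-≈ {x} {y} {z} (mk≈ x≈z) (mk< ε 0<ε M h) with δ , 0<δ , δ+δ≡ε ← half 0<ε
  with N , k ← x≈z δ 0<δ =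
  mk< δ 0<δ (M ⊔ N) λ n n≥ → begin-strict
    seq z n ℚ.+ δ
      <⟨ ℚ.+-monoˡ-< δ (∣p-q∣<ε⇒q<p+ε (seq x n) (seq z n) (k n (ℕ.m⊔n≤o⇒n≤o M N n≥))) ⟩
    seq x n ℚ.+ δ ℚ.+ δ      ≡⟨ ℚ.+-assoc (seq x n) δ δ ⟩
    seq x n ℚ.+ (δ ℚ.+ δ)    ≡⟨ cong (seq x n ℚ.+_) δ+δ≡ε ⟩
    seq x n ℚ.+ ε            <⟨ h n (ℕ.m⊔n≤o⇒m≤o M N n≥) ⟩
    seq y n                  ∎
  where open ℚ.≤-Reasoning

-- If at some late index x lies ε below y, then x stays below y by ε / 2,
-- as both sequences move by less than ε / 4 from there on.
≮⇒eventually-< : ∀ x y → ¬ x < y → ∀ ε → 0ℚ ℚ.< ε →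
  ∃ λ N → ∀ n → N ℕ.≤ n → seq y n ℚ.< seq x n ℚ.+ ε
≮⇒eventually-< x y x≮y ε 0<ε with η , 0<η , η+η≡ε ← half 0<ε
  with δ , 0<δ , δ+δ≡η ← half 0<η
  with M , hx ← cauchy x δ 0<δ | N , hy ← cauchy y δ 0<δ =
  M ⊔ N , λ n n≥ → ℚ.≰⇒> λ x+ε≤y → x≮y (mk< η 0<η (M ⊔ N) λ m m≥ → +-cancelʳ-< δ (begin-strict
    seq x m ℚ.+ η ℚ.+ δ
      <⟨ ℚ.+-monoˡ-< δ (ℚ.+-monoˡ-< η (∣p-q∣<ε⇒p<q+ε (seq x m) (seq x n)
           (hx m n (ℕ.m⊔n≤o⇒m≤o M N m≥) (ℕ.m⊔n≤o⇒m≤o M N n≥)))) ⟩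
    seq x n ℚ.+ δ ℚ.+ η ℚ.+ δ
      ≡⟨ solve 3 (λ x δ η → x :+ δ :+ η :+ δ := x :+ (η :+ (δ :+ δ))) refl (seq x n) δ η ⟩
    seq x n ℚ.+ (η ℚ.+ (δ ℚ.+ δ))
      ≡⟨ cong (λ d → seq x n ℚ.+ (η ℚ.+ d)) δ+δ≡η ⟩
    seq x n ℚ.+ (η ℚ.+ η)   ≡⟨ cong (seq x n ℚ.+_) η+η≡ε ⟩
    seq x n ℚ.+ ε           ≤⟨ x+ε≤y ⟩
    seq y n
      <⟨ ∣p-q∣<ε⇒p<q+ε (seq y n) (seq y m)
           (hy n m (ℕ.m⊔n≤o⇒n≤o M N n≥) (ℕ.m⊔n≤o⇒n≤o M N m≥)) ⟩
    seq y m ℚ.+ δ           ∎))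
  where open ℚ.≤-Reasoning

-- Supplies the equality case of trichotomy once both strict comparisons have been decided
-- negatively.
≮∧≯⇒≈ : ∀ {x y} → ¬ x < y → ¬ y < x → x ≈ y
≮∧≯⇒≈ {x} {y} x≮y y≮x = mk≈ λ ε 0<ε →
  let M , y< = ≮⇒eventually-< x y x≮y ε 0<ε
      N , x< = ≮⇒eventually-< y x y≮x ε 0<ε
  in M ⊔ N , λ n n≥ → p<q+ε⇒q<p+ε⇒∣p-q∣<ε (seq x n) (seq y n)
    (x< n (ℕ.m⊔n≤o⇒n≤o M N n≥)) (y< n (ℕ.m⊔n≤o⇒m≤o M N n≥))

-- A slope above `δ` turns a gap `ε` into one of at least `δ * ε`. This bound is independent of the
-- index, as a gap in `_<_` has to be.
affine-mono-< : ∀ {α β δ ε p q} → 0ℚ ℚ.< δ → δ ℚ.< α → 0ℚ ℚ.< ε → p ℚ.+ ε ℚ.< q →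
  α ℚ.* p ℚ.+ β ℚ.+ δ ℚ.* ε ℚ.< α ℚ.* q ℚ.+ β
affine-mono-< {α} {β} {δ} {ε} {p} {q} 0<δ δ<α 0<ε p+ε<q = begin-strict
    α ℚ.* p ℚ.+ β ℚ.+ δ ℚ.* ε
      <⟨ ℚ.+-monoʳ-< (α ℚ.* p ℚ.+ β) (ℚ.*-monoˡ-<-pos ε {{positive 0<ε}} δ<α) ⟩
    α ℚ.* p ℚ.+ β ℚ.+ α ℚ.* ε
      ≡⟨ solve 4 (λ α p β ε → α :* p :+ β :+ α :* ε := α :* (p :+ ε) :+ β) refl α p β ε ⟩
    α ℚ.* (p ℚ.+ ε) ℚ.+ β
      <⟨ ℚ.+-monoˡ-< β (ℚ.*-monoʳ-<-pos α {{positive (ℚ.<-trans 0<δ δ<α)}} p+ε<q) ⟩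
    α ℚ.* q ℚ.+ β ∎
  where open ℚ.≤-Reasoning

apply-mono-< : ∀ f x y → x < y → apply f x < apply f y
apply-mono-< f x y (mk< ε 0<ε M x<y) =
  let mk< δ 0<δ N δ<a = DirectSimilarity.a>0 f
  in mk< (δ ℚ.* ε) (*-pos 0<δ 0<ε) (M ⊔ N) λ n n≥ →
    affine-mono-< {seq (DirectSimilarity.a f) n} {seq (DirectSimilarity.b f) n} 0<δ
      (subst (ℚ._< seq (DirectSimilarity.a f) n) (ℚ.+-identityˡ δ) (δ<a n (ℕ.m⊔n≤o⇒n≤o M N n≥)))
      0<ε (x<y n (ℕ.m⊔n≤o⇒m≤o M N n≥))

-- Subtracting the agreement at `x` from that at `y` leaves `(y - x) * (a - a′)`, and `y - x`
-- eventually exceeds `ε`, so the slopes agree. At `z` the difference is `(z - x) * (a - a′)` plus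
-- the difference at `x`.
apply-determined : ∀ f g x y → x < y → apply f x ≈ apply g x → apply f y ≈ apply g y →
  ∀ z → apply f z ≈ apply g z
apply-determined f g x y (mk< ε 0<ε N x<y) (mk≈ fx≈gx) (mk≈ fy≈gy) z =
  mk≈ (null-cong
    (λ n → solve 6 (λ a b a′ b′ x z →
        (z :* (a :- a′) :- x :* (a :- a′)) :+ ((a :* x :+ b) :- (a′ :* x :+ b′)) :=
        (a :* z :+ b) :- (a′ :* z :+ b′))
      refl (seq a n) (seq b n) (seq a′ n) (seq b′ n) (seq x n) (seq z n))
    (null-+ (null-- (null-*ˡ z a-a′) (null-*ˡ x a-a′)) fx≈gx))
  where
  open DirectSimilarity f using (a; b)
  open DirectSimilarity g using () renaming (a to a′; b to b′)
  ε<y-x : ∀ n → N ℕ.≤ n → ε ℚ.< seq y n ℚ.- seq x n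
  ε<y-x n n≥ = +-cancelʳ-< (seq x n) (subst₂ ℚ._<_ (ℚ.+-comm (seq x n) ε)
    (solve 2 (λ x y → y := y :- x :+ x) refl (seq x n) (seq y n)) (x<y n n≥))
  a-a′ : Null (λ n → seq a n ℚ.- seq a′ n)
  a-a′ = null-*-cancel (λ n → seq y n ℚ.- seq x n) 0<ε ε<y-x (null-cong
    (λ n → solve 6 (λ a b a′ b′ x y →
        ((a :* y :+ b) :- (a′ :* y :+ b′)) :- ((a :* x :+ b) :- (a′ :* x :+ b′)) :=
        (y :- x) :* (a :- a′))
      refl (seq a n) (seq b n) (seq a′ n) (seq b′ n) (seq x n) (seq y n))
    (null-- fy≈gy fx≈gx))

_≺[_]_ : ∀ {n} → Fin n → PointSet n → Fin n → Set
i ≺[ V ] j = point V i < point V j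

-- Only up to ¬¬, as comparing reals is undecidable.
¬¬-isStrictTotalOrder : ∀ {n} (V : PointSet n) → ¬ ¬ IsStrictTotalOrder _≡_ (_≺[ V ]_)
¬¬-isStrictTotalOrder {n} V = order <$> ∀-¬¬ (λ i → ∀-¬¬ (λ j → ¬¬-excluded-middle))
  where
  open RawMonad {f = 0ℓ} ¬¬-Monad
  -- Double negation commutes with finite conjunctions, so all comparisons of the `n` points may be
  -- decided at once.
  ∀-¬¬ : ∀ {P : Fin n → Set} → (∀ i → ¬ ¬ P i) → ¬ ¬ (∀ i → P i)
  ∀-¬¬ = Fin.sequence rawApplicative
  order : (∀ i j → Dec (i ≺[ V ] j)) → IsStrictTotalOrder _≡_ (_≺[ V ]_)
  order _≺?_ = isStrictTotalOrderᶜ record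
    { isEquivalence = isEquivalence
    ; trans         = <-trans
    ; compare       = compare
    }
    where
    compare : ∀ i j → _
    compare i j with i ≺? j | j ≺? i
    ... | yes i≺j | _ = tri< i≺j (λ { refl → <-irrefl i≺j }) (λ j≺i → <-irrefl (<-trans i≺j j≺i))
    ... | no  i⊀j | yes j≺i = tri> i⊀j (λ { refl → <-irrefl j≺i }) j≺i
    ... | no  i⊀j | no j⊀i = tri≈ i⊀j (distinct V (≮∧≯⇒≈ i⊀j j⊀i)) j⊀i

-- Counting the copies

lookup-injective : ∀ {A : Set} {xs : List A} → Unique xs → Injective _≡_ _≡_ (lookup xs)
lookup-injective (x∉ ∷ u) {zero}  {zero}  eq = refl
lookup-injective {xs = _ ∷ xs} (x∉ ∷ u) {zero}  {suc j} eq =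
  contradiction eq (All.lookup x∉ (∈-lookup {xs = xs} j))
lookup-injective {xs = _ ∷ xs} (x∉ ∷ u) {suc i} {zero}  eq =
  contradiction (sym eq) (All.lookup x∉ (∈-lookup {xs = xs} i))
lookup-injective (x∉ ∷ u) {suc i} {suc j} eq = cong suc (lookup-injective u eq)

-- Here `ι i s` is the index in `V` of the image of pattern point `s`. Equal ranks mean the same
-- point of `V`, so two copies sharing a consecutive pair at the same `t` come from similarities
-- that agree at two distinct points.
copies≤ : ∀ {m K n} .{{_ : NonZero K}} (P₀ : PointSet (suc K)) (V : PointSet n) →
  IsStrictTotalOrder _≡_ (_≺[ P₀ ]_) → IsStrictTotalOrder _≡_ (_≺[ V ]_) →
  (f : Fin m → DirectSimilarity) (ι : Fin m → Fin (suc K) → Fin n) →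
  (∀ i s → apply (f i) (point P₀ s) ≈ point V (ι i s)) →
  (∀ i j → (∀ z → apply (f i) z ≈ apply (f j) z) → i ≡ j) →
  m ℕ.≤ prefixSum (ℕ._/ K) n
copies≤ {K = K} P₀ V stoP stoV f ι fp≈v f-injective = increasing-sequences≤
  (λ i t → toℕ (rank (ι i (nth t))))
  (λ i t → Fin.toℕ<n (rank (ι i (nth t))))
  (λ i t → rank-mono (ι-mono i (consecutive t)))
  (λ i j t x≡ y≡ → f-injective i j (apply-determined (f i) (f j)
    (point P₀ (nth (inject₁ t))) (point P₀ (nth (suc t))) (consecutive t)
    (agree i j (nth (inject₁ t)) x≡) (agree i j (nth (suc t)) y≡)))
  where
  open Rank stoP using (nth; nth-mono)
  open Rank stoV using (rank; rank-mono; rank-injective)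

  consecutive : ∀ (t : Fin K) → nth (inject₁ t) ≺[ P₀ ] nth (suc t)
  consecutive t = nth-mono (ℕ.s≤s (ℕ.≤-reflexive (Fin.toℕ-inject₁ t)))

  ι-mono : ∀ i {s s′} → s ≺[ P₀ ] s′ → ι i s ≺[ V ] ι i s′
  ι-mono i {s} {s′} s≺s′ = <-respˡ-≈ (fp≈v i s)
    (<-respʳ-≈ {apply (f i) (point P₀ s)} (fp≈v i s′)
      (apply-mono-< (f i) (point P₀ s) (point P₀ s′) s≺s′))

  agree : ∀ i j s → toℕ (rank (ι i s)) ≡ toℕ (rank (ι j s)) →
    apply (f i) (point P₀ s) ≈ apply (f j) (point P₀ s)
  agree i j s eq = ≈-trans {y = point V (ι j s)}
    (subst (λ v → apply (f i) (point P₀ s) ≈ point V v)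
      (rank-injective (Fin.toℕ-injective eq)) (fp≈v i s))
    (≈-sym {y = point V (ι j s)} (fp≈v j s))

-- From listed subsets to similarities

apply-∈-image : ∀ f (A : Pred ℝ 0ℓ) x → A x → image f A (apply f x)
apply-∈-image f A x Ax = x , Ax , ≈-refl

image-cong : ∀ f g {A : Pred ℝ 0ℓ} → (∀ z → apply f z ≈ apply g z) → image f A ⊆ᵣ image g A
image-cong f g f≗g {y} (x , Ax , y≈fx) = x , Ax , ≈-trans y≈fx (f≗g x)

↾-reflects-⊆ : ∀ {n} (V : PointSet n) {I J} → (V ↾ I) ⊆ᵣ (V ↾ J) → I ⊆ J
↾-reflects-⊆ V {J = J} V↾I⊆V↾J {i} i∈I =
  let j , j∈J , vi≈vj = V↾I⊆V↾J {point V i} (i , i∈I , ≈-refl)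
  in subst (_∈ J) (sym (distinct V vi≈vj)) j∈J

image≗⇒⊆ : ∀ {n} (V : PointSet n) A f g {I J} → (V ↾ I) ⊆ᵣ image f A → image g A ⊆ᵣ (V ↾ J) →
  (∀ z → apply f z ≈ apply g z) → I ⊆ J
image≗⇒⊆ V A f g I⊆ ⊆J f≗g = ↾-reflects-⊆ V λ {y} y∈ → ⊆J (image-cong f g f≗g (I⊆ y∈))

-- Similarities that agree everywhere have the same image, hence give the same listed subset, and a
-- list without repetition has it at only one position.
length-copies≤ : ∀ {K n} .{{_ : NonZero K}} (P₀ : PointSet (suc K)) (V : PointSet n) →
  IsStrictTotalOrder _≡_ (_≺[ P₀ ]_) → IsStrictTotalOrder _≡_ (_≺[ V ]_) →
  ∀ {Is} → Unique Is → (f : Fin (length Is) → DirectSimilarity) →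
  (∀ i → V ↾ lookup Is i ≐ image (f i) ⟦ P₀ ⟧) →
  length Is ℕ.≤ prefixSum (ℕ._/ K) n
length-copies≤ P₀ V stoP stoV {Is} unique f ≐f = copies≤ P₀ V stoP stoV f
  (λ i s → proj₁ (vertex i s))
  (λ i s → proj₂ (proj₂ (vertex i s)))
  (λ i j f≗g → lookup-injective unique (⊆-antisym
    (image≗⇒⊆ V ⟦ P₀ ⟧ (f i) (f j) (proj₁ (≐f i)) (proj₂ (≐f j)) f≗g)
    (image≗⇒⊆ V ⟦ P₀ ⟧ (f j) (f i) (proj₁ (≐f j)) (proj₂ (≐f i)) λ z → ≈-sym (f≗g z))))
  where
  vertex : ∀ i s → (V ↾ lookup Is i) (apply (f i) (point P₀ s))
  vertex i s = proj₂ (≐f i) {apply (f i) (point P₀ s)}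
    (apply-∈-image (f i) ⟦ P₀ ⟧ (point P₀ s) (s , ≈-refl))

open import Data.Rational using (_/_)

mainTheorem5 : ∀ (k : ℕ) .{{_ : NonTrivial k}} (𝒫 : Pred (Pred ℝ 0ℓ) 0ℓ) → IsPattern k 𝒫 →
    ∀ (n : ℕ) .{{_ : NonZero n}} → let r = n % (k ℕ.∸ 1) in
    ∀ (m : ℕ) → Smax[ 𝒫 , n ]≡ m →
    (+ m / 1) ℚ.≤
    _/_ ((+ n ℤ.- + r) ℤ.* (+ n ℤ.+ + r ℤ.- + k ℤ.+ + 1))
    (2 ℕ.* k ℕ.∸ 2) {{2k∸2-nonZero k}}
mainTheorem5 k@(suc K@(suc _)) 𝒫 (P₀ , 𝒫⊆ , _) n m ((V , Is , unique , Is⇔ , refl) , _) =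
  decidable-stable (_ ℚ.≤? _) λ ≰ →
    ¬¬-isStrictTotalOrder P₀ λ stoP → ¬¬-isStrictTotalOrder V λ stoV → ≰
      -- The numerator is the sum of quotients times the denominator, so the claim reduces to
      -- comparing `m` with that sum.
      (subst (λ p → (+ m / 1) ℚ.≤ _/_ p (2 ℕ.* k ℕ.∸ 2) {{2k∸2-nonZero k}})
        (sym (bound-numerator K n))
        (m≤s⇒m/1≤s*d/d (2 ℕ.* k ℕ.∸ 2) {{2k∸2-nonZero k}}
          (length-copies≤ P₀ V stoP stoV unique
            (λ i → proj₁ (copy i)) (λ i → proj₂ (copy i)))))
  where
  copy : ∀ i → ∃ λ f → V ↾ lookup Is i ≐ image f ⟦ P₀ ⟧
  copy i = 𝒫⊆ (Equivalence.to (Is⇔ (lookup Is i)) (∈-lookup i))
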